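{- Let $\mathcal{A}$ be a finite set of positive integers, let $w \leqslant z$ be real numbers, and let $m_1, \dots, m_6$ be real numbers with $(m_1, m_2) \in \mathcal{U}$, $(m_3, m_4) \in \mathcal{U}$ and $(m_5, m_6) \in \mathcal{U}$. Writing $M^r_6 = \sum_{1 \leqslant i_1 < \cdots < i_r \leqslant 6} m_{i_1}\cdots m_{i_r}$ and $P = m_1m_2m_3m_4m_5m_6$, we have $$ S(\mathcal{A}, z) \leqslant S(\mathcal{A}, w) - \frac{M^5_6 - M^4_6 + M^3_6 - M^2_6 + M^1_6 - 1}{P} \sum_{w \leqslant p_1 < z} S(\mathcal{A}_{p_1}, w) + \frac{2(M^4_6 - 3M^3_6 + 7M^2_6 - 15M^1_6 + 31)}{P} \sum_{w \leqslant p_2 < p_1 < z} S(\mathcal{A}_{p_1p_2}, w) $$ $$ - \frac{6(M^3_6 - 6M^2_6 + 25M^1_6 - 90)}{P} \sum_{w \leqslant p_3 < p_2 < p_1 < z} S(\mathcal{A}_{p_1p_2p_3}, w) + \frac{24(M^2_6 - 10M^1_6 + 65)}{P} \sum_{w \leqslant p_4 < \cdots < p_1 < z} S(\mathcal{A}_{p_1p_2p_3p_4}, w) $$ $$ - \frac{120(M^1_6 - 15)}{P} \sum_{w \leqslant p_5 < \cdots < p_1 < z} S(\mathcal{A}_{p_1\cdots p_5}, w) + \frac{720}{P} \sum_{w \leqslant p_6 < \cdots < p_1 < z} S(\mathcal{A}_{p_1\cdots p_6}, w). $$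
   Context: Throughout, $p, p_1, p_2, \dots$ denote prime numbers. For a finite set $\mathcal{A}$ of positive integers and a positive integer $d$, $\mathcal{A}_d = \{a : ad \in \mathcal{A}\}$. For real $z$, $S(\mathcal{A}, z)$ denotes the number of $a \in \mathcal{A}$ having no prime factor less than $z$. Let $T = (0,1] \cup [2,3] \cup [4,5] \cup \cdots$, i.e. $T$ is the union of $(0,1]$ and the intervals $[k-1,k]$ over all odd integers $k \geqslant 3$, and let $\mathcal{U} = \{(x_1, x_2) : x_1, x_2 \in T,\ |x_1 - x_2| \leqslant 1\}$. -}

module Defs where

open import Level using (Level; _⊔_) renaming (suc to lsuc)
open import Algebra.Bundles using (CommutativeRing)
import Algebra.Properties.Ring as RingProperties
import Algebra.Properties.Semiring.Mult as Mult
open import Data.List.Base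
  using (List; []; _∷_; _++_; map; foldr; filter; upTo; concatMap; length)
open import Data.List.Extrema.Nat using (max; xs≤max)
open import Data.List.Membership.Propositional using (_∈_)
open import Data.List.Membership.Propositional.Properties using (∈-filter⁺; ∈-filter⁻; ∈-upTo⁺)
import Data.List.Relation.Unary.All as All
open import Data.Nat.Base as ℕ using (ℕ; zero; suc; NonZero)
open import Data.Nat.Divisibility using (_∣_; _∣?_)
open import Data.Nat.ListAction using (product) renaming (sum to sumℕ)
open import Data.Nat.Primality using (Prime; prime?)
import Data.Nat.Properties as ℕₚ
open import Data.List.Membership.DecPropositional ℕₚ._≟_ using (_∈?_)
open import Data.Product.Base using (∃; ∃-syntax; _×_; _,_; proj₁; proj₂)
open import Data.Sum.Base using (_⊎_; inj₁; inj₂)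
open import Function.Base using (_∘_)
open import Function.Bundles using (_⇔_; mk⇔)
open import Relation.Binary.Bundles using (DecTotalOrder)
open import Relation.Binary.Core using (Rel)
import Relation.Binary.Construct.NonStrictToStrict as ToStrict
import Relation.Binary.Properties.DecTotalOrder as OrderProperties
open import Relation.Binary.Structures using (IsDecTotalOrder)
open import Relation.Nullary using (¬_; Dec; yes; no; ¬?; contradiction)
open import Relation.Nullary.Decidable using (map′; _×-dec_; _→-dec_)
open import Relation.Unary using (Pred; Decidable; Satisfiable)

-- The real numbers, given by their axioms: a Dedekind-complete ordered field.
-- Classically these axioms determine ℝ up to isomorphism.  Decidability of
-- the order is trichotomy in its constructive reading.
record RealNumbers (c ℓ : Level) : Set (lsuc (c ⊔ ℓ)) where
  infix  4 _≤_
  infix  8 _⁻¹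
  field
    commutativeRing : CommutativeRing c ℓ

  open CommutativeRing commutativeRing public

  field
    _≤_             : Rel Carrier ℓ
    isDecTotalOrder : IsDecTotalOrder _≈_ _≤_

  open ToStrict _≈_ _≤_ public using (_<_)

  field
    1≉0        : ¬ 1# ≈ 0#
    +-monoˡ-≤  : ∀ z {x y} → x ≤ y → x + z ≤ y + z
    *-nonneg   : ∀ {x y} → 0# ≤ x → 0# ≤ y → 0# ≤ x * y
    -- 0# ⁻¹ is left unspecified.
    _⁻¹        : Carrier → Carrier
    *-inverseʳ : ∀ x → ¬ x ≈ 0# → x * x ⁻¹ ≈ 1#

  UpperBound : Pred Carrier ℓ → Carrier → Set (c ⊔ ℓ)
  UpperBound P b = ∀ {x} → P x → x ≤ b

  -- Leastness of the bound is stated as: whatever is below the supremum is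
  -- below some element of P.  This is classically equivalent to being below
  -- every other upper bound, and yields witnesses constructively.
  IsSupremum : Pred Carrier ℓ → Carrier → Set (c ⊔ ℓ)
  IsSupremum P s = UpperBound P s × (∀ {y} → y < s → ∃[ x ] P x × y < x)

  field
    supremum : ∀ P → Satisfiable P → ∃ (UpperBound P) → ∃ (IsSupremum P)

  decTotalOrder : DecTotalOrder c ℓ ℓ
  decTotalOrder = record { isDecTotalOrder = isDecTotalOrder }

  open IsDecTotalOrder isDecTotalOrder public
    using (_≤?_; _≟_; total; antisym; ≤-respˡ-≈; ≤-respʳ-≈)
    renaming (refl to ≤-refl; trans to ≤-trans; reflexive to ≤-reflexive)
  open OrderProperties decTotalOrder public using (≰⇒>; <⇒≱; ≮⇒≥)

  infixl 7 _/_
  _/_ : Carrier → Carrier → Carrier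
  x / y = x * y ⁻¹

  _<?_ : ∀ x y → Dec (x < y)
  _<?_ = ToStrict.<-decidable _≈_ _≤_ _≟_ _≤?_

  ∣_∣ : Carrier → Carrier
  ∣ x ∣ with 0# ≤? x
  ... | yes _ = x
  ... | no  _ = - x

  open Mult semiring using () renaming (_×_ to _×ᵣ_)

  ι : ℕ → Carrier
  ι n = n ×ᵣ 1#

module _ {c ℓ} (ℝ : RealNumbers c ℓ) where
  open RealNumbers ℝ
  open RingProperties ring using (-1*x≈-x; -‿involutive)

  0≤1 : 0# ≤ 1#
  0≤1 with total 0# 1#
  ... | inj₁ p = p
  ... | inj₂ p = ≤-respʳ-≈ eq (*-nonneg 0≤-1 0≤-1)
    where
    0≤-1 : 0# ≤ - 1#
    0≤-1 = ≤-respˡ-≈ (-‿inverseʳ 1#) (≤-respʳ-≈ (+-identityˡ (- 1#)) (+-monoˡ-≤ (- 1#) p))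
    eq : - 1# * - 1# ≈ 1#
    eq = trans (-1*x≈-x (- 1#)) (-‿involutive 1#)

  x≤1+x : ∀ x → x ≤ 1# + x
  x≤1+x x = ≤-respˡ-≈ (+-identityˡ x) (+-monoˡ-≤ x 0≤1)

  1+x≰x : ∀ x → ¬ 1# + x ≤ x
  1+x≰x x p = 1≉0 (antisym
    (≤-respˡ-≈ (trans (+-assoc 1# x (- x)) (trans (+-congˡ (-‿inverseʳ x)) (+-identityʳ 1#)))
      (≤-respʳ-≈ (-‿inverseʳ x) (+-monoˡ-≤ (- x) p)))
    0≤1)

  1+[x-1]≈x : ∀ x → (x - 1#) + 1# ≈ x
  1+[x-1]≈x x = trans (+-assoc x (- 1#) 1#) (trans (+-congˡ (-‿inverseˡ 1#)) (+-identityʳ x))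

  ι-mono-≤′ : ∀ {m n} → m ℕ.≤′ n → ι m ≤ ι n
  ι-mono-≤′ (ℕ.≤′-reflexive eq) rewrite eq = ≤-refl
  ι-mono-≤′ (ℕ.≤′-step p)       = ≤-trans (ι-mono-≤′ p) (x≤1+x _)

  ι-cancel-< : ∀ {m n} → ι m < ι n → m ℕ.< n
  ι-cancel-< {m} {n} p =
    ℕₚ.≰⇒> λ n≤m → contradiction (ι-mono-≤′ (ℕₚ.≤⇒≤′ n≤m)) (<⇒≱ p)

  archimedean : ∀ x → ∃[ n ] x < ι n
  archimedean x with total x 0#
  ... | inj₁ x≤0 =
    1 , ≰⇒> λ ι1≤x → 1+x≰x 0# (≤-trans ι1≤x x≤0)
  ... | inj₂ 0≤x with supremum (λ y → y ≤ x × ∃[ n ] y ≤ ι n)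
                        (0# , 0≤x , 0 , ≤-refl) (x , proj₁)
  ...   | s , bound , approx with approx {s - 1#} (≰⇒> λ s≤s-1 → 1+x≰x s
              (≤-respˡ-≈ (+-comm s 1#) (≤-respʳ-≈ (1+[x-1]≈x s) (+-monoˡ-≤ 1# s≤s-1))))
  ...     | y , (_ , n , y≤n) , (s-1≤y , s-1≉y) =
    suc n , ≰⇒> λ n+1≤x → s-1≉y (antisym s-1≤y (≤-trans y≤n (n≤s-1 n+1≤x)))
    where
    1+n-1≈n : (1# + ι n) - 1# ≈ ι n
    1+n-1≈n = trans (+-congʳ (+-comm 1# (ι n)))
      (trans (+-assoc (ι n) 1# (- 1#)) (trans (+-congˡ (-‿inverseʳ 1#)) (+-identityʳ (ι n))))
    n≤s-1 : ι (suc n) ≤ x → ι n ≤ s - 1#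
    n≤s-1 p = ≤-respˡ-≈ 1+n-1≈n (+-monoˡ-≤ (- 1#) (bound (p , suc n , ≤-refl)))

  -- All natural numbers below z (as reals) are below ceil z.
  ceil : Carrier → ℕ
  ceil z = proj₁ (archimedean z)

  <⇒<ceil : ∀ {n z} → ι n < z → n ℕ.< ceil z
  <⇒<ceil {n} {z} n<z = ℕₚ.≰⇒> λ b≤n →
    contradiction (≤-trans (proj₁ (proj₂ (archimedean z))) (ι-mono-≤′ (ℕₚ.≤⇒≤′ b≤n))) (<⇒≱ n<z)

-- A_d = { a : a d ∈ A }, for a finite set A given as a list.
infixl 7 _/ₛ_
_/ₛ_ : List ℕ → ℕ → List ℕ
A /ₛ d = filter (λ a → a ℕ.* d ∈? A) (upTo (suc (max 0 A)))

∈-/ₛ : ∀ A d .{{_ : NonZero d}} {a} → a ∈ A /ₛ d ⇔ a ℕ.* d ∈ A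
∈-/ₛ A d {a} = mk⇔
  (λ a∈ → proj₂ (∈-filter⁻ (λ b → b ℕ.* d ∈? A) {xs = upTo (suc (max 0 A))} a∈))
  (λ ad∈A → ∈-filter⁺ (λ b → b ℕ.* d ∈? A)
    (∈-upTo⁺ (ℕ.s≤s (ℕₚ.≤-trans (ℕₚ.m≤m*n a d) (All.lookup (xs≤max 0 A) ad∈A)))) ad∈A)

-- The sublists of length r; for xs = x₁ ∷ … ∷ xₙ these are the tuples
-- (x_{i₁}, …, x_{iᵣ}) with i₁ < ⋯ < iᵣ.
combinations : ∀ {a} {X : Set a} → ℕ → List X → List (List X)
combinations zero    xs       = [] ∷ []
combinations (suc r) []       = []
combinations (suc r) (x ∷ xs) = map (x ∷_) (combinations r xs) ++ combinations (suc r) xs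

module Sieve {c ℓ} (ℝ : RealNumbers c ℓ) where
  open RealNumbers ℝ

  Rough : Carrier → Pred ℕ ℓ
  Rough z a = ∀ {p} → Prime p → p ∣ a → ¬ ι p < z

  rough? : ∀ z → Decidable (Rough z)
  rough? z a = map′
    (λ f {p} pr p∣a p<z → f (<⇒<ceil ℝ p<z) pr p∣a p<z)
    (λ f {p} _ → f {p})
    (ℕₚ.allUpTo? (λ p → prime? p →-dec (p ∣? a →-dec ¬? (ι p <? z))) (ceil ℝ z))

  S : List ℕ → Carrier → ℕ
  S A z = length (filter (rough? z) A)

  PrimeIn : Carrier → Carrier → Pred ℕ ℓ
  PrimeIn w z p = Prime p × w ≤ ι p × ι p < z

  primeIn? : ∀ w z → Decidable (PrimeIn w z)
  primeIn? w z p = prime? p ×-dec (w ≤? ι p ×-dec ι p <? z)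

  primes : Carrier → Carrier → List ℕ
  primes w z = filter (primeIn? w z) (upTo (ceil ℝ z))

  ∈-primes : ∀ w z {p} → p ∈ primes w z ⇔ PrimeIn w z p
  ∈-primes w z = mk⇔
    (proj₂ ∘ ∈-filter⁻ (primeIn? w z) {xs = upTo (ceil ℝ z)})
    (λ h → ∈-filter⁺ (primeIn? w z) (∈-upTo⁺ (<⇒<ceil ℝ (proj₂ (proj₂ h)))) h)

  -- All tuples p₁ ∷ ⋯ ∷ pᵣ of primes with w ≤ pᵣ < ⋯ < p₁ < z.
  primeTuples : ℕ → Carrier → Carrier → List (List ℕ)
  primeTuples zero    w z = [] ∷ []
  primeTuples (suc r) w z = concatMap (λ p → map (p ∷_) (primeTuples r w (ι p))) (primes w z)

  -- ∑ S(A_{p₁⋯pᵣ}, w) over all w ≤ pᵣ < ⋯ < p₁ < z.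
  ∑S : ℕ → List ℕ → Carrier → Carrier → ℕ
  ∑S r A w z = sumℕ (map (λ ps → S (A /ₛ product ps) w) (primeTuples r w z))

  T : Pred Carrier ℓ
  T x = (0# < x × x ≤ 1#)
      ⊎ ∃[ k ] (¬ 2 ∣ k) × 3 ℕ.≤ k × ι k - 1# ≤ x × x ≤ ι k

  𝒰 : Carrier → Carrier → Set ℓ
  𝒰 x₁ x₂ = T x₁ × T x₂ × ∣ x₁ - x₂ ∣ ≤ 1#

  sumᵣ productᵣ : List Carrier → Carrier
  sumᵣ     = foldr _+_ 0#
  productᵣ = foldr _*_ 1#

  -- ∑ m_{i₁} ⋯ m_{iᵣ} over all i₁ < ⋯ < iᵣ.
  elementary : ℕ → List Carrier → Carrier
  elementary r ms = sumᵣ (map productᵣ (combinations r ms))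

{-# OPTIONS --safe #-}

-- Let ω(a) be the number of primes in [w, z) dividing a.  The r-fold sum counts
-- each w-rough a ∈ A with multiplicity C(ω(a), r), while S(A, z) counts those
-- with ω(a) = 0.  The coefficients on the right are those of ∏ (mᵢ - n) / P in
-- the basis of binomial coefficients C(n, r), so each such a contributes
-- ∏ (mᵢ - ω(a)) / P.  This is 1 if ω(a) = 0, and it is never negative: for
-- (x, y) ∈ 𝒰 no natural number lies strictly between x and y.
module Submission where

open import Algebra.Bundles using (CommutativeRing)
import Algebra.Properties.AbelianGroup as AbelianGroupProperties
import Algebra.Properties.Ring as RingProperties
import Algebra.Properties.Semiring.Mult as Mult
import Algebra.Solver.Ring as RingSolver
open import Algebra.Solver.Ring.AlmostCommutativeRing
  using (fromCommutativeRing; _-Raw-AlmostCommutative⟶_; Induced-equivalence)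
open import Data.Bool.Base using (if_then_else_)
open import Data.Integer.Base as ℤ using (ℤ; -[1+_]; _⊖_)
import Data.Integer.Properties as ℤₚ
open import Data.List.Base
  using (List; []; _∷_; _++_; map; concatMap; length; filter; upTo)
open import Data.List.Extrema.Nat using (max)
open import Data.List.Membership.Propositional using (_∈_; find)
open import Data.List.Membership.Propositional.Properties
  using (∈-filter⁺; ∈-filter⁻; ∈-map⁺; ∈-map⁻; ∈-concatMap⁻; ∈-upTo⁺; ∈-upTo⁻; ∈-length)
open import Data.List.Membership.Propositional.Properties.WithK using (unique∧set⇒bag)
open import Data.List.Properties
  using (map-++; map-∘; map-cong; map-cong-local; length-map; length-++
        ; filter-++; filter-≐; filter-none; upTo-∷ʳ)
open import Data.List.Relation.Binary.BagAndSetEquality using (∼bag⇒↭)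
open import Data.List.Relation.Binary.Permutation.Propositional.Properties using (↭-length)
open import Data.List.Relation.Unary.All as All using (All; []; _∷_)
open import Data.List.Relation.Unary.Any using (here; there)
open import Data.List.Relation.Unary.Unique.Propositional using (Unique)
import Data.List.Relation.Unary.Unique.Propositional.Properties as Unique
open import Data.Maybe.Base as Maybe using ()
open import Data.Nat.Base as ℕ using (ℕ; zero; suc; NonZero; _!)
open import Data.Nat.Combinatorics using (_C_; nC1≡n; nCk+nC[k+1]≡[n+1]C[k+1])
open import Data.Nat.Divisibility
  using (_∣_; _∤_; _∣?_; divides; ∣-refl; ∣-trans; ∣1⇒≡1; 1∣_; m∣m*n; n∣m*n
        ; ∣m⇒∣m*n; *-monoˡ-∣; ∣m∣n⇒∣m+n)
open import Data.Nat.ListAction using (sum; product)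
open import Data.Nat.ListAction.Properties using (sum-++)
open import Data.Nat.Primality
  using (Prime; prime⇒irreducible; euclidsLemma; ¬prime[1]; productOfPrimes≢0)
import Data.Nat.Properties as ℕₚ
open import Algebra.Properties.CommutativeSemigroup ℕₚ.+-commutativeSemigroup
  using (interchange)
open import Data.List.Membership.DecPropositional ℕₚ._≟_ using (_∈?_)
open import Data.Nat.Solver using (module +-*-Solver)
open import Data.Product.Base using (∃; _×_; _,_; proj₁; proj₂)
import Data.Sign.Base as Sign
open import Data.Sum.Base using (_⊎_; inj₁; inj₂)
open import Function.Base using (_∘_)
open import Function.Bundles using (_⇔_; mk⇔; Equivalence)
import Relation.Binary.Reasoning.Setoid as SetoidReasoning
open import Relation.Binary.PropositionalEquality as ≡ using (_≡_)
open import Relation.Nullary using (¬_; Dec; yes; no; does; contradiction; _×-dec_)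
open import Relation.Nullary.Decidable.Core using (dec⇒maybe)
open import Relation.Binary.Definitions using (WeaklyDecidable)
open import Relation.Unary using (Pred; Decidable)
open import Defs

open Equivalence using (to; from)

-- The constants are Stirling numbers of the second kind: 1, 3, 7, 15, 31, then 1, 6, 25, 90, then
-- 1, 10, 65, then 1, 15 are the S(j, k) for k = 2, 3, 4, 5 and j = k, ..., 6. Expanding ∏ (mᵢ - n)
-- = ∑ⱼ (-n)ʲ e₆₋ⱼ and inserting nʲ = ∑ₖ S(j, k) k! C(n, k) gives C(n, k) the coefficient k! ∑ⱼ
-- (-1)ʲ S(j, k) e₆₋ⱼ. The formal argument runs the other way: k! C(n, k) is replaced by n (n - 1) ⋯
-- (n - k + 1), and what remains is a polynomial identity for a ring solver. The components of T are
-- intervals of length 1 with odd right ends, separated by open gaps of length 1. Two points of T at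
-- distance at most 1 therefore share a component or are the facing ends of neighbouring ones, and
-- neither leaves room for a natural number strictly between. A single factor mᵢ - n can change sign
-- as n grows; only the product over a pair is controlled.

module _ where
  open ≡
  open import Data.Nat.Base using (_+_; _*_; _<_; _≤_)

  -- Sums and counts over lists, in natural numbers

  length-set : ∀ {a} {X : Set a} {xs ys : List X} → Unique xs → Unique ys →
    (∀ {x} → x ∈ xs ⇔ x ∈ ys) → length xs ≡ length ys
  length-set uxs uys eq = ↭-length (∼bag⇒↭ (unique∧set⇒bag uxs uys eq))

  filter-filter : ∀ {a p q} {X : Set a} {P : Pred X p} {Q : Pred X q}
    (P? : Decidable P) (Q? : Decidable Q) →
    ∀ xs → filter Q? (filter P? xs) ≡ filter (λ x → P? x ×-dec Q? x) xs
  filter-filter P? Q? [] = refl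
  filter-filter P? Q? (x ∷ xs) with P? x
  ... | no  _ = filter-filter P? Q? xs
  ... | yes _ with Q? x
  ...   | yes _ = cong (x ∷_) (filter-filter P? Q? xs)
  ...   | no  _ = filter-filter P? Q? xs

  indicator : ∀ {p} {P : Set p} → Dec P → ℕ
  indicator P? = if does P? then 1 else 0

  indicator-true : ∀ {p} {P : Set p} (P? : Dec P) → P → indicator P? ≡ 1
  indicator-true (yes _) _ = refl
  indicator-true (no ¬p) p = contradiction p ¬p

  indicator-× : ∀ {p q r} {P : Set p} {Q : Set q} {R : Set r} (P? : Dec P) (Q? : Dec Q) (R? : Dec R) →
    R ⇔ (P × Q) → indicator R? ≡ indicator P? * indicator Q?
  indicator-× (yes p) (yes q) (yes r) eq = refl
  indicator-× (yes p) (yes q) (no ¬r) eq = contradiction (from eq (p , q)) ¬r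
  indicator-× (no ¬p) _       (no ¬r) eq = refl
  indicator-× (no ¬p) _       (yes r) eq = contradiction (proj₁ (to eq r)) ¬p
  indicator-× (yes p) (no ¬q) (no ¬r) eq = refl
  indicator-× (yes p) (no ¬q) (yes r) eq = contradiction (proj₂ (to eq r)) ¬q

  sum-map-0 : ∀ {a} {X : Set a} (xs : List X) → sum (map (λ _ → 0) xs) ≡ 0
  sum-map-0 []       = refl
  sum-map-0 (x ∷ xs) = sum-map-0 xs

  sum-map-1 : ∀ {a} {X : Set a} (xs : List X) → sum (map (λ _ → 1) xs) ≡ length xs
  sum-map-1 []       = refl
  sum-map-1 (x ∷ xs) = cong suc (sum-map-1 xs)

  sum-map-+ : ∀ {a} {X : Set a} (f g : X → ℕ) xs →
    sum (map (λ x → f x + g x) xs) ≡ sum (map f xs) + sum (map g xs)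
  sum-map-+ f g []       = refl
  sum-map-+ f g (x ∷ xs) =
    trans (cong (f x + g x +_) (sum-map-+ f g xs)) (interchange (f x) (g x) _ _)

  sum-map-swap : ∀ {a b} {X : Set a} {Y : Set b} (f : X → Y → ℕ) xs ys →
    sum (map (λ x → sum (map (f x) ys)) xs) ≡ sum (map (λ y → sum (map (λ x → f x y) xs)) ys)
  sum-map-swap f []       ys = sym (sum-map-0 ys)
  sum-map-swap f (x ∷ xs) ys =
    trans (cong (sum (map (f x) ys) +_) (sum-map-swap f xs ys)) (sym (sum-map-+ (f x) _ ys))

  module _ {a} {X : Set a} where

    sum-map-*ˡ : ∀ k (f : X → ℕ) xs → sum (map (λ x → k * f x) xs) ≡ k * sum (map f xs)
    sum-map-*ˡ k f []       = sym (ℕₚ.*-zeroʳ k)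
    sum-map-*ˡ k f (x ∷ xs) =
      trans (cong (k * f x +_) (sum-map-*ˡ k f xs)) (sym (ℕₚ.*-distribˡ-+ k (f x) _))

    sum-map-concatMap : ∀ {b} {Y : Set b} (g : Y → ℕ) (f : X → List Y) xs →
      sum (map g (concatMap f xs)) ≡ sum (map (λ x → sum (map g (f x))) xs)
    sum-map-concatMap g f []       = refl
    sum-map-concatMap g f (x ∷ xs) = begin
      sum (map g (f x ++ concatMap f xs))            ≡⟨ cong sum (map-++ g (f x) _) ⟩
      sum (map g (f x) ++ map g (concatMap f xs))    ≡⟨ sum-++ (map g (f x)) _ ⟩
      sum (map g (f x)) + sum (map g (concatMap f xs))
        ≡⟨ cong (sum (map g (f x)) +_) (sum-map-concatMap g f xs) ⟩
      sum (map g (f x)) + sum (map (λ x → sum (map g (f x))) xs) ∎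
      where open ≡-Reasoning

    module _ {p} {P : Pred X p} (P? : Decidable P) where

      sum-map-filter : ∀ (g : X → ℕ) xs →
        sum (map g (filter P? xs)) ≡ sum (map (λ x → indicator (P? x) * g x) xs)
      sum-map-filter g []       = refl
      sum-map-filter g (x ∷ xs) with P? x
      ... | yes _ = cong₂ _+_ (sym (ℕₚ.*-identityˡ (g x))) (sum-map-filter g xs)
      ... | no  _ = sum-map-filter g xs

      length-filter≡sum : ∀ xs → length (filter P? xs) ≡ sum (map (indicator ∘ P?) xs)
      length-filter≡sum []       = refl
      length-filter≡sum (x ∷ xs) with P? x
      ... | yes _ = cong suc (length-filter≡sum xs)
      ... | no  _ = length-filter≡sum xs

  -- Sort the (r+1)-subsets of the numbers below n satisfying Q by their largest element p: the
  -- other r elements are chosen below p. In the induction `upTo` grows at its end, and Pascal's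
  -- rule absorbs the new term.
  hockey-stick : ∀ {q} {Q : Pred ℕ q} (Q? : Decidable Q) r n →
    sum (map (λ p → length (filter Q? (upTo p)) C r) (filter Q? (upTo n))) ≡
      length (filter Q? (upTo n)) C suc r
  hockey-stick Q? r zero    = refl
  hockey-stick Q? r (suc n) = begin
    sum (map f (filter Q? (upTo (suc n))))
      ≡⟨ cong (sum ∘ map f) split ⟩
    sum (map f (filter Q? (upTo n) ++ filter Q? (n ∷ [])))
      ≡⟨ trans (cong sum (map-++ f (filter Q? (upTo n)) _)) (sum-++ (map f (filter Q? (upTo n))) _) ⟩
    sum (map f (filter Q? (upTo n))) + sum (map f (filter Q? (n ∷ [])))
      ≡⟨ cong (_+ sum (map f (filter Q? (n ∷ [])))) (hockey-stick Q? r n) ⟩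
    c C suc r + sum (map f (filter Q? (n ∷ [])))
      ≡⟨ last ⟩
    (c + length (filter Q? (n ∷ []))) C suc r
      ≡⟨ cong (_C suc r) (trans (cong length split) (length-++ (filter Q? (upTo n)))) ⟨
    length (filter Q? (upTo (suc n))) C suc r ∎
    where
    open ≡-Reasoning
    f : ℕ → ℕ
    f p = length (filter Q? (upTo p)) C r
    c = length (filter Q? (upTo n))
    split : filter Q? (upTo (suc n)) ≡ filter Q? (upTo n) ++ filter Q? (n ∷ [])
    split = trans (cong (filter Q?) (sym (upTo-∷ʳ n))) (filter-++ Q? (upTo n) (n ∷ []))
    last : c C suc r + sum (map f (filter Q? (n ∷ []))) ≡ (c + length (filter Q? (n ∷ []))) C suc r
    last with Q? n
    ... | no  _ = trans (ℕₚ.+-identityʳ _) (cong (_C suc r) (sym (ℕₚ.+-identityʳ c)))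
    ... | yes _ = begin
      c C suc r + (c C r + 0)  ≡⟨ cong (c C suc r +_) (ℕₚ.+-identityʳ _) ⟩
      c C suc r + c C r        ≡⟨ ℕₚ.+-comm (c C suc r) _ ⟩
      c C r + c C suc r        ≡⟨ nCk+nC[k+1]≡[n+1]C[k+1] c r ⟩
      suc c C suc r            ≡⟨ cong (_C suc r) (ℕₚ.+-comm 1 c) ⟩
      (c + 1) C suc r          ∎

  -- Divisibility by primes, binomial coefficients, parity

  prime∣prime⇒≡ : ∀ {p q} → Prime p → Prime q → p ∣ q → p ≡ q
  prime∣prime⇒≡ pp pq p∣q with prime⇒irreducible pq p∣q
  ... | inj₁ refl = contradiction pp ¬prime[1]
  ... | inj₂ p≡q  = p≡q

  prime∣product⇒∈ : ∀ {p ps} → Prime p → All Prime ps → p ∣ product ps → p ∈ ps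
  prime∣product⇒∈ pp [] p∣1 = contradiction (subst Prime (∣1⇒≡1 p∣1) pp) ¬prime[1]
  prime∣product⇒∈ {ps = q ∷ ps} pp (pq ∷ pps) p∣q*qs with euclidsLemma q (product ps) pp p∣q*qs
  ... | inj₁ p∣q  = here (prime∣prime⇒≡ pp pq p∣q)
  ... | inj₂ p∣qs = there (prime∣product⇒∈ pp pps p∣qs)

  -- With n = k * d, Euclid's lemma forces p into k, since p does not divide d.
  p*d∣n⇔p∣n×d∣n : ∀ {p d n} → Prime p → p ∤ d → p * d ∣ n ⇔ (p ∣ n × d ∣ n)
  p*d∣n⇔p∣n×d∣n {p} {d} {n} pp p∤d = mk⇔
    (λ pd∣n → ∣-trans (m∣m*n d) pd∣n , ∣-trans (n∣m*n p) pd∣n)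
    λ { (p∣n , divides k refl) → step k (euclidsLemma k d pp p∣n) }
    where
    step : ∀ k → p ∣ k ⊎ p ∣ d → p * d ∣ k * d
    step k (inj₁ p∣k) = *-monoˡ-∣ d p∣k
    step k (inj₂ p∣d) = contradiction p∣d p∤d

  -- Absorption, with terms moved so that no truncated subtraction occurs.
  [1+k]*nC[1+k]+k*nCk≡n*nCk : ∀ n k → suc k * (n C suc k) + k * (n C k) ≡ n * (n C k)
  [1+k]*nC[1+k]+k*nCk≡n*nCk n       zero    = begin
    1 * (n C 1) + 0  ≡⟨ ℕₚ.+-identityʳ _ ⟩
    1 * (n C 1)      ≡⟨ ℕₚ.*-identityˡ _ ⟩
    n C 1            ≡⟨ nC1≡n n ⟩
    n                ≡⟨ ℕₚ.*-identityʳ n ⟨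
    n * 1            ∎
    where open ≡-Reasoning
  [1+k]*nC[1+k]+k*nCk≡n*nCk zero    (suc k) = cong₂ _+_ (ℕₚ.*-zeroʳ k) (ℕₚ.*-zeroʳ k)
  [1+k]*nC[1+k]+k*nCk≡n*nCk (suc n) (suc k) = begin
    suc (suc k) * (suc n C suc (suc k)) + suc k * (suc n C suc k)
      ≡⟨ cong₂ (λ x y → suc (suc k) * x + suc k * y)
           (nCk+nC[k+1]≡[n+1]C[k+1] n (suc k)) (nCk+nC[k+1]≡[n+1]C[k+1] n k) ⟨
    suc (suc k) * (b + c) + suc k * (a + b)
      -- Regrouped so that the first two brackets are the left sides of the induction hypothesis at
      -- `suc k` and at `k`; the leftover a + b is `suc n C suc k`.
      ≡⟨ solve 4 (λ k a b c → (con 2 :+ k) :* (b :+ c) :+ (con 1 :+ k) :* (a :+ b)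
           := ((con 2 :+ k) :* c :+ (con 1 :+ k) :* b) :+ ((con 1 :+ k) :* b :+ k :* a) :+ (a :+ b))
           refl k a b c ⟩
    (suc (suc k) * c + suc k * b) + (suc k * b + k * a) + (a + b)
      ≡⟨ cong₂ (λ x y → x + y + (a + b))
           ([1+k]*nC[1+k]+k*nCk≡n*nCk n (suc k)) ([1+k]*nC[1+k]+k*nCk≡n*nCk n k) ⟩
    n * b + n * a + (a + b)
      ≡⟨ solve 3 (λ n a b → n :* b :+ n :* a :+ (a :+ b) := (con 1 :+ n) :* (a :+ b)) refl n a b ⟩
    suc n * (a + b)
      ≡⟨ cong (suc n *_) (nCk+nC[k+1]≡[n+1]C[k+1] n k) ⟩
    suc n * (suc n C suc k) ∎
    where
    open ≡-Reasoning
    open +-*-Solver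
    a = n C k
    b = n C suc k
    c = n C suc (suc k)

  2∣n⊎2∣1+n : ∀ n → 2 ∣ n ⊎ 2 ∣ suc n
  2∣n⊎2∣1+n zero    = inj₁ (divides 0 refl)
  2∣n⊎2∣1+n (suc n) with 2∣n⊎2∣1+n n
  ... | inj₁ 2∣n   = inj₂ (∣m∣n⇒∣m+n ∣-refl 2∣n)
  ... | inj₂ 2∣1+n = inj₁ 2∣1+n

  -- One of two consecutive numbers is even, which excludes l = 1 + k.
  odd-gap : ∀ {k l} → 2 ∤ k → 2 ∤ l → k < l → 2 + k ≤ l
  odd-gap {k} 2∤k 2∤l k<l with ℕₚ.m≤n⇒m<n∨m≡n k<l | 2∣n⊎2∣1+n k
  ... | inj₁ 1+k<l  | _          = 1+k<l
  ... | inj₂ _      | inj₁ 2∣k   = contradiction 2∣k 2∤k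
  ... | inj₂ refl   | inj₂ 2∣1+k = contradiction 2∣1+k 2∤l

-- A ring solver with integer coefficients for an arbitrary commutative ring

module IntegerSolver {c ℓ} (R : CommutativeRing c ℓ) where
  open import Data.Integer.Base using (+_)
  open CommutativeRing R
  open RingProperties ring
  open AbelianGroupProperties +-abelianGroup using (⁻¹-∙-comm)
  open Mult semiring using (×-homo-+; ×1-homo-*) renaming (_×_ to _×ᵣ_)
  open SetoidReasoning setoid

  -- The clause for 1 lets con (+ 1) denote 1# instead of 1# + 0#.
  ⟦_⟧ : ℤ → Carrier
  ⟦ + 1 ⟧      = 1#
  ⟦ + n ⟧      = n ×ᵣ 1#
  ⟦ -[1+ n ] ⟧ = - (suc n ×ᵣ 1#)

  ⟦+_⟧ : ∀ n → ⟦ + n ⟧ ≈ n ×ᵣ 1#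
  ⟦+ 0 ⟧           = refl
  ⟦+ 1 ⟧           = sym (+-identityʳ 1#)
  ⟦+ suc (suc n) ⟧ = refl

  private
    cancel : ∀ x y z → x - y ≈ (z + x) - (z + y)
    cancel x y z = sym (begin
      (z + x) - (z + y)    ≈⟨ +-cong (+-comm z x) (sym (⁻¹-∙-comm z y)) ⟩
      (x + z) + (- z - y)  ≈⟨ +-assoc x z _ ⟩
      x + (z + (- z - y))  ≈⟨ +-congˡ (+-assoc z (- z) (- y)) ⟨
      x + ((z - z) - y)    ≈⟨ +-congˡ (+-congʳ (-‿inverseʳ z)) ⟩
      x + (0# - y)         ≈⟨ +-congˡ (+-identityˡ (- y)) ⟩
      x - y                ∎)

    ⟦⊖⟧ : ∀ m n → ⟦ m ⊖ n ⟧ ≈ m ×ᵣ 1# - n ×ᵣ 1#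
    ⟦⊖⟧ m zero = begin
      ⟦ + m ⟧       ≈⟨ ⟦+ m ⟧ ⟩
      m ×ᵣ 1#       ≈⟨ +-identityʳ _ ⟨
      m ×ᵣ 1# + 0#  ≈⟨ +-congˡ -0#≈0# ⟨
      m ×ᵣ 1# - 0#  ∎
    ⟦⊖⟧ zero (suc n) = sym (+-identityˡ _)
    ⟦⊖⟧ (suc m) (suc n) = begin
      ⟦ suc m ⊖ suc n ⟧          ≡⟨ ≡.cong ⟦_⟧ (ℤₚ.[1+m]⊖[1+n]≡m⊖n m n) ⟩
      ⟦ m ⊖ n ⟧                  ≈⟨ ⟦⊖⟧ m n ⟩
      m ×ᵣ 1# - n ×ᵣ 1#          ≈⟨ cancel _ _ 1# ⟩
      suc m ×ᵣ 1# - suc n ×ᵣ 1#  ∎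

    ⟦-⟧ : ∀ i → ⟦ ℤ.- i ⟧ ≈ - ⟦ i ⟧
    ⟦-⟧ (+ 0)            = sym -0#≈0#
    ⟦-⟧ (+ 1)            = -‿cong (+-identityʳ 1#)
    ⟦-⟧ (+ suc (suc n))  = refl
    ⟦-⟧ -[1+ n ]         = trans ⟦+ suc n ⟧ (sym (-‿involutive _))

    ⟦+⟧ : ∀ i j → ⟦ i ℤ.+ j ⟧ ≈ ⟦ i ⟧ + ⟦ j ⟧
    ⟦+⟧ (+ m) (+ n) = begin
      ⟦ + (m ℕ.+ n) ⟧    ≈⟨ ⟦+ m ℕ.+ n ⟧ ⟩
      (m ℕ.+ n) ×ᵣ 1#    ≈⟨ ×-homo-+ 1# m n ⟩
      m ×ᵣ 1# + n ×ᵣ 1#  ≈⟨ +-cong ⟦+ m ⟧ ⟦+ n ⟧ ⟨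
      ⟦ + m ⟧ + ⟦ + n ⟧  ∎
    ⟦+⟧ (+ m) -[1+ n ] = trans (⟦⊖⟧ m (suc n)) (+-congʳ (sym ⟦+ m ⟧))
    ⟦+⟧ -[1+ m ] (+ n) =
      trans (⟦⊖⟧ n (suc m)) (trans (+-comm _ _) (+-congˡ (sym ⟦+ n ⟧)))
    ⟦+⟧ -[1+ m ] -[1+ n ] = begin
      - (suc (suc (m ℕ.+ n)) ×ᵣ 1#)      ≡⟨ ≡.cong (λ k → - (k ×ᵣ 1#)) (ℕₚ.+-suc (suc m) n) ⟨
      - ((suc m ℕ.+ suc n) ×ᵣ 1#)        ≈⟨ -‿cong (×-homo-+ 1# (suc m) (suc n)) ⟩
      - (suc m ×ᵣ 1# + suc n ×ᵣ 1#)      ≈⟨ ⁻¹-∙-comm _ _ ⟨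
      - (suc m ×ᵣ 1#) + - (suc n ×ᵣ 1#)  ∎

    ⟦+◃⟧ : ∀ n → ⟦ Sign.+ ℤ.◃ n ⟧ ≈ n ×ᵣ 1#
    ⟦+◃⟧ n = trans (reflexive (≡.cong ⟦_⟧ (ℤₚ.+◃n≡+n n))) ⟦+ n ⟧

    ⟦-◃⟧ : ∀ n → ⟦ Sign.- ℤ.◃ n ⟧ ≈ - (n ×ᵣ 1#)
    ⟦-◃⟧ n = trans (reflexive (≡.cong ⟦_⟧ (ℤₚ.-◃n≡-n n))) (trans (⟦-⟧ (+ n)) (-‿cong ⟦+ n ⟧))

    ⟦*⟧ : ∀ i j → ⟦ i ℤ.* j ⟧ ≈ ⟦ i ⟧ * ⟦ j ⟧
    ⟦*⟧ (+ m) (+ n) = begin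
      ⟦ + m ℤ.* + n ⟧        ≈⟨ ⟦+◃⟧ (m ℕ.* n) ⟩
      (m ℕ.* n) ×ᵣ 1#        ≈⟨ ×1-homo-* m n ⟩
      (m ×ᵣ 1#) * (n ×ᵣ 1#)  ≈⟨ *-cong ⟦+ m ⟧ ⟦+ n ⟧ ⟨
      ⟦ + m ⟧ * ⟦ + n ⟧      ∎
    ⟦*⟧ (+ m) -[1+ n ] = begin
      ⟦ + m ℤ.* -[1+ n ] ⟧           ≈⟨ ⟦-◃⟧ (m ℕ.* suc n) ⟩
      - ((m ℕ.* suc n) ×ᵣ 1#)        ≈⟨ -‿cong (×1-homo-* m (suc n)) ⟩
      - ((m ×ᵣ 1#) * (suc n ×ᵣ 1#))  ≈⟨ -‿distribʳ-* _ _ ⟩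
      (m ×ᵣ 1#) * - (suc n ×ᵣ 1#)    ≈⟨ *-congʳ ⟦+ m ⟧ ⟨
      ⟦ + m ⟧ * - (suc n ×ᵣ 1#)      ∎
    ⟦*⟧ -[1+ m ] (+ n) = begin
      ⟦ -[1+ m ] ℤ.* + n ⟧           ≈⟨ ⟦-◃⟧ (suc m ℕ.* n) ⟩
      - ((suc m ℕ.* n) ×ᵣ 1#)        ≈⟨ -‿cong (×1-homo-* (suc m) n) ⟩
      - ((suc m ×ᵣ 1#) * (n ×ᵣ 1#))  ≈⟨ -‿distribˡ-* _ _ ⟩
      - (suc m ×ᵣ 1#) * (n ×ᵣ 1#)    ≈⟨ *-congˡ ⟦+ n ⟧ ⟨
      - (suc m ×ᵣ 1#) * ⟦ + n ⟧      ∎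
    ⟦*⟧ -[1+ m ] -[1+ n ] = begin
      ⟦ -[1+ m ] ℤ.* -[1+ n ] ⟧          ≈⟨ ⟦+◃⟧ (suc m ℕ.* suc n) ⟩
      (suc m ℕ.* suc n) ×ᵣ 1#            ≈⟨ ×1-homo-* (suc m) (suc n) ⟩
      (suc m ×ᵣ 1#) * (suc n ×ᵣ 1#)      ≈⟨ -x*-y≈x*y _ _ ⟨
      - (suc m ×ᵣ 1#) * - (suc n ×ᵣ 1#)  ∎
      where
      -x*-y≈x*y : ∀ x y → - x * - y ≈ x * y
      -x*-y≈x*y x y = begin
        - x * - y    ≈⟨ -‿distribˡ-* x (- y) ⟨
        - (x * - y)  ≈⟨ -‿cong (-‿distribʳ-* x y) ⟨
        - - (x * y)  ≈⟨ -‿involutive _ ⟩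
        x * y        ∎

    morphism : ℤ.+-*-rawRing -Raw-AlmostCommutative⟶ fromCommutativeRing R
    morphism = record
      { ⟦_⟧ = ⟦_⟧ ; +-homo = ⟦+⟧ ; *-homo = ⟦*⟧ ; -‿homo = ⟦-⟧ ; 0-homo = refl ; 1-homo = refl }

    -- Coefficients are compared in ℤ, where equality computes. Numerals of an abstract ring do not
    -- evaluate, so the solver could not cancel them there.
    _coeff≟_ : WeaklyDecidable (Induced-equivalence morphism)
    i coeff≟ j = Maybe.map (λ i≡j → reflexive (≡.cong ⟦_⟧ i≡j)) (dec⇒maybe (i ℤₚ.≟ j))

  open RingSolver ℤ.+-*-rawRing (fromCommutativeRing R) morphism _coeff≟_
    public using (solve; _:=_; _:+_; _:*_; _:-_; :-_; con)

-- Elementary symmetric polynomials and the passage to binomial coefficients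

module Polynomials {c ℓ} (ℝ : RealNumbers c ℓ) where
  open import Data.Integer.Base using (+_)
  open RealNumbers ℝ
  open Sieve ℝ using (sumᵣ; productᵣ; elementary)
  open IntegerSolver commutativeRing
  open Mult semiring using (×-homo-+; ×1-homo-*)
  open SetoidReasoning setoid

  sumᵣ-++ : ∀ xs ys → sumᵣ (xs ++ ys) ≈ sumᵣ xs + sumᵣ ys
  sumᵣ-++ []       ys = sym (+-identityˡ _)
  sumᵣ-++ (x ∷ xs) ys = trans (+-congˡ (sumᵣ-++ xs ys)) (sym (+-assoc x _ _))

  sumᵣ-map-product-∷ : ∀ x xss → sumᵣ (map productᵣ (map (x ∷_) xss)) ≈ x * sumᵣ (map productᵣ xss)
  sumᵣ-map-product-∷ x []         = sym (zeroʳ x)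
  sumᵣ-map-product-∷ x (xs ∷ xss) =
    trans (+-congˡ (sumᵣ-map-product-∷ x xss)) (sym (distribˡ x _ _))

  elementary-zero : ∀ xs → elementary 0 xs ≈ 1#
  elementary-zero xs = +-identityʳ 1#

  -- The combinations containing x, then those avoiding it.
  elementary-∷ : ∀ r x xs → elementary (suc r) (x ∷ xs) ≈ x * elementary r xs + elementary (suc r) xs
  elementary-∷ r x xs = begin
    sumᵣ (map productᵣ (map (x ∷_) (combinations r xs) ++ combinations (suc r) xs))
      ≡⟨ ≡.cong sumᵣ (map-++ productᵣ (map (x ∷_) (combinations r xs)) _) ⟩
    sumᵣ (map productᵣ (map (x ∷_) (combinations r xs)) ++ map productᵣ (combinations (suc r) xs))
      ≈⟨ sumᵣ-++ (map productᵣ (map (x ∷_) (combinations r xs))) _ ⟩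
    sumᵣ (map productᵣ (map (x ∷_) (combinations r xs))) + elementary (suc r) xs
      ≈⟨ +-congʳ (sumᵣ-map-product-∷ x (combinations r xs)) ⟩
    x * elementary r xs + elementary (suc r) xs ∎

  -- ∑ⱼ (-t)ʲ eₖ₋ⱼ(xs), the coefficient of uᵏ in ∏ (1 + x u) / (1 + t u);
  -- for k = length xs it is ∏ (x - t).
  alternating : Carrier → ℕ → List Carrier → Carrier
  alternating t zero    xs = 1#
  alternating t (suc k) xs = elementary (suc k) xs - t * alternating t k xs

  -- Adjoining x multiplies the generating function by 1 + x u.
  alternating-∷ : ∀ t k x xs →
    alternating t (suc k) (x ∷ xs) ≈ x * alternating t k xs + alternating t (suc k) xs
  alternating-∷ t zero x xs = begin
    elementary 1 (x ∷ xs) - t * 1#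
      ≈⟨ +-congʳ (trans (elementary-∷ 0 x xs) (+-congʳ (*-congˡ (elementary-zero xs)))) ⟩
    (x * 1# + elementary 1 xs) - t * 1#
      ≈⟨ +-assoc _ _ _ ⟩
    x * 1# + (elementary 1 xs - t * 1#) ∎
  alternating-∷ t (suc k) x xs = begin
    elementary (2 ℕ.+ k) (x ∷ xs) - t * alternating t (suc k) (x ∷ xs)
      ≈⟨ +-cong (elementary-∷ (suc k) x xs) (-‿cong (*-congˡ (alternating-∷ t k x xs))) ⟩
    (x * e₁ + e₂) - t * (x * a + a₁)
      ≈⟨ solve 6 (λ x t e₁ e₂ a a₁ → (x :* e₁ :+ e₂) :- t :* (x :* a :+ a₁)
           := x :* (e₁ :- t :* a) :+ (e₂ :- t :* a₁)) refl x t e₁ e₂ a a₁ ⟩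
    x * (e₁ - t * a) + (e₂ - t * a₁) ∎
    where
    e₁ = elementary (suc k) xs
    e₂ = elementary (2 ℕ.+ k) xs
    a = alternating t k xs
    a₁ = alternating t (suc k) xs

  elementary-length< : ∀ {r} xs → length xs ℕ.< r → elementary r xs ≈ 0#
  elementary-length< {suc r} []       _           = refl
  elementary-length< {suc r} (x ∷ xs) (ℕ.s≤s n<r) = begin
    elementary (suc r) (x ∷ xs)
      ≈⟨ elementary-∷ r x xs ⟩
    x * elementary r xs + elementary (suc r) xs
      ≈⟨ +-cong (*-congˡ (elementary-length< xs n<r)) (elementary-length< xs (ℕₚ.m<n⇒m<1+n n<r)) ⟩
    x * 0# + 0#
      ≈⟨ trans (+-identityʳ _) (zeroʳ x) ⟩
    0# ∎

  vieta : ∀ t xs → productᵣ (map (_- t) xs) ≈ alternating t (length xs) xs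
  vieta t []       = refl
  vieta t (x ∷ xs) = begin
    (x - t) * productᵣ (map (_- t) xs)
      ≈⟨ *-congˡ (vieta t xs) ⟩
    (x - t) * a
      ≈⟨ solve 3 (λ x t a → (x :- t) :* a := x :* a :+ (con (+ 0) :- t :* a)) refl x t a ⟩
    x * a + (0# - t * a)
      -- An elementary symmetric polynomial of degree above the number of entries vanishes, so
      -- `0# - t * a` is the next coefficient for `xs`.
      ≈⟨ +-congˡ (+-congʳ (elementary-length< xs ℕₚ.≤-refl)) ⟨
    x * a + alternating t (suc (length xs)) xs
      ≈⟨ alternating-∷ t (length xs) x xs ⟨
    alternating t (length (x ∷ xs)) (x ∷ xs) ∎
    where a = alternating t (length xs) xs

  -- The falling factorial t (t - 1) ⋯ (t - k + 1): a polynomial form of k! C(t, k) that the solver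
  -- can expand.
  falling : Carrier → ℕ → Carrier
  falling t zero    = 1#
  falling t (suc k) = (t - ι k) * falling t k

  k!*nCk≈falling : ∀ n k → ι (k !) * ι (n C k) ≈ falling (ι n) k
  k!*nCk≈falling n zero    = trans (*-congʳ (+-identityʳ 1#)) (trans (*-identityˡ _) (+-identityʳ 1#))
  k!*nCk≈falling n (suc k) = begin
    ι (suc k !) * ι (n C suc k)
      ≈⟨ *-congʳ (×1-homo-* (suc k) (k !)) ⟩
    (ι (suc k) * ι (k !)) * b₁
      ≈⟨ solve 3 (λ s f b → (s :* f) :* b := f :* (s :* b)) refl (ι (suc k)) (ι (k !)) b₁ ⟩
    ι (k !) * (ι (suc k) * b₁)
      ≈⟨ *-congˡ absorb ⟩
    ι (k !) * ((ι n - ι k) * b)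
      ≈⟨ solve 3 (λ f d b → f :* (d :* b) := d :* (f :* b)) refl (ι (k !)) (ι n - ι k) b ⟩
    (ι n - ι k) * (ι (k !) * b)
      ≈⟨ *-congˡ (k!*nCk≈falling n k) ⟩
    (ι n - ι k) * falling (ι n) k ∎
    where
    b = ι (n C k)
    b₁ = ι (n C suc k)
    sum≈ : ι (suc k) * b₁ + ι k * b ≈ ι n * b
    sum≈ = begin
      ι (suc k) * b₁ + ι k * b
        ≈⟨ +-cong (×1-homo-* (suc k) (n C suc k)) (×1-homo-* k (n C k)) ⟨
      ι (suc k ℕ.* (n C suc k)) + ι (k ℕ.* (n C k))
        ≈⟨ ×-homo-+ 1# (suc k ℕ.* (n C suc k)) (k ℕ.* (n C k)) ⟨
      ι (suc k ℕ.* (n C suc k) ℕ.+ k ℕ.* (n C k))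
        ≡⟨ ≡.cong ι ([1+k]*nC[1+k]+k*nCk≡n*nCk n k) ⟩
      ι (n ℕ.* (n C k))
        ≈⟨ ×1-homo-* n (n C k) ⟩
      ι n * b ∎
    -- The absorption identity is transported from ℕ without subtraction; `ι k * b` is subtracted
    -- only in the ring, where n - k may be negative.
    absorb : ι (suc k) * b₁ ≈ (ι n - ι k) * b
    absorb = begin
      ι (suc k) * b₁
        ≈⟨ solve 2 (λ x y → x := (x :+ y) :- y) refl (ι (suc k) * b₁) (ι k * b) ⟩
      (ι (suc k) * b₁ + ι k * b) - ι k * b
        ≈⟨ +-congʳ sum≈ ⟩
      ι n * b - ι k * b
        ≈⟨ solve 3 (λ n k b → n :* b :- k :* b := (n :- k) :* b) refl (ι n) (ι k) b ⟩
      (ι n - ι k) * b ∎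

  -- The right-hand side of the theorem as a linear function of its seven counts, so that it applies
  -- equally to the binomials of one element and to the totals.
  combination : (M : ℕ → Carrier) (P : Carrier) (b : ℕ → Carrier) → Carrier
  combination M P b =
    b 0
    - (M 5 - M 4 + M 3 - M 2 + M 1 - 1#) / P * b 1
    + ι 2 * (M 4 - ι 3 * M 3 + ι 7 * M 2 - ι 15 * M 1 + ι 31) / P * b 2
    - ι 6 * (M 3 - ι 6 * M 2 + ι 25 * M 1 - ι 90) / P * b 3
    + ι 24 * (M 2 - ι 10 * M 1 + ι 65) / P * b 4
    - ι 120 * (M 1 - ι 15) / P * b 5
    + ι 720 / P * b 6

  module _ (M : ℕ → Carrier) (P : Carrier) where

    combination-cong : ∀ {b b′} → (∀ r → b r ≈ b′ r) → combination M P b ≈ combination M P b′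
    combination-cong eq =
      +-cong (+-cong (+-cong (+-cong (+-cong (+-cong (eq 0)
        (-‿cong (*-congˡ (eq 1)))) (*-congˡ (eq 2))) (-‿cong (*-congˡ (eq 3))))
        (*-congˡ (eq 4))) (-‿cong (*-congˡ (eq 5)))) (*-congˡ (eq 6))

    -- Evaluates the two base situations: the empty list, and an element with no prime counted, for
    -- which `0 C r` vanishes when r > 0.
    combination-head : ∀ b → (∀ r → b (suc r) ≈ 0#) → combination M P b ≈ b 0
    combination-head b tail≈0 = trans (combination-cong {b} {b₀} b≈b₀)
      (solve 7 (λ x c₁ c₂ c₃ c₄ c₅ c₆ →
        x :- c₁ :* con (+ 0) :+ c₂ :* con (+ 0) :- c₃ :* con (+ 0)
          :+ c₄ :* con (+ 0) :- c₅ :* con (+ 0) :+ c₆ :* con (+ 0) := x)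
        refl _ _ _ _ _ _ _)
      where
      b₀ : ℕ → Carrier
      b₀ zero    = b 0
      b₀ (suc _) = 0#
      b≈b₀ : ∀ r → b r ≈ b₀ r
      b≈b₀ zero    = refl
      b≈b₀ (suc r) = tail≈0 r

    combination-+ : ∀ b b′ →
      combination M P (λ r → b r + b′ r) ≈ combination M P b + combination M P b′
    combination-+ b b′ =
      plus _ (minus _ (plus _ (minus _ (plus _ (minus _ refl)))))
      where
      plus : ∀ c {x y z u v} → x ≈ y + z → x + c * (u + v) ≈ (y + c * u) + (z + c * v)
      plus c {x} {y} {z} {u} {v} eq = trans (+-congʳ eq)
        (solve 5 (λ c y z u v → (y :+ z) :+ c :* (u :+ v) := (y :+ c :* u) :+ (z :+ c :* v))
          refl c y z u v)
      minus : ∀ c {x y z u v} → x ≈ y + z → x - c * (u + v) ≈ (y - c * u) + (z - c * v)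
      minus c {x} {y} {z} {u} {v} eq = trans (+-congʳ eq)
        (solve 5 (λ c y z u v → (y :+ z) :- c :* (u :+ v) := (y :- c :* u) :+ (z :- c :* v))
          refl c y z u v)

  module _ (ms : List Carrier) (P : Carrier) where
    private
      M : ℕ → Carrier
      M r = elementary r ms

    combination-binomial : M 6 ≈ P → ¬ P ≈ 0# → length ms ≡ 6 → ∀ n →
      combination M P (λ r → ι (n C r)) ≈ productᵣ (map (_- ι n) ms) / P
    combination-binomial M6≈P P≉0 eq n = begin
      combination M P (λ r → ι (n C r))
        -- The leading 1 becomes `P * I`, so that every term carries `I`. The constants 2, 6, 24,
        -- 120, 720 are the k! that turn binomials into falling factorials.
        ≈⟨ +-cong (+-cong (+-cong (+-cong (+-cong (+-cong
             (trans (+-identityʳ 1#) (sym (*-inverseʳ P P≉0)))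
             (-‿cong (*-congˡ (f1 (k!*nCk≈falling n 1)))))
             (scale _ _ _ _ (k!*nCk≈falling n 2)))
             (-‿cong (scale _ _ _ _ (k!*nCk≈falling n 3))))
             (scale _ _ _ _ (k!*nCk≈falling n 4)))
             (-‿cong (scale _ _ _ _ (k!*nCk≈falling n 5))))
             (scale′ _ _ _ (k!*nCk≈falling n 6)) ⟩
      P * I
      - (M 5 - M 4 + M 3 - M 2 + M 1 - 1#) / P * falling N 1
      + (M 4 - ι 3 * M 3 + ι 7 * M 2 - ι 15 * M 1 + ι 31) / P * falling N 2
      - (M 3 - ι 6 * M 2 + ι 25 * M 1 - ι 90) / P * falling N 3
      + (M 2 - ι 10 * M 1 + ι 65) / P * falling N 4
      - (M 1 - ι 15) / P * falling N 5
      + I * falling N 6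
        ≈⟨ solve 8 (λ N P I m₁ m₂ m₃ m₄ m₅ →
             -- These must unfold to the values of `falling`: `ι 1` is `1# + 0#`, whereas
             -- `con (+ 1)` denotes `1#`, hence the explicit zero in `f2`.
             let f1 = (N :- con (+ 0)) :* con (+ 1)
                 f2 = (N :- (con (+ 1) :+ con (+ 0))) :* f1
                 f3 = (N :- con (+ 2)) :* f2
                 f4 = (N :- con (+ 3)) :* f3
                 f5 = (N :- con (+ 4)) :* f4
                 f6 = (N :- con (+ 5)) :* f5
             in P :* I
               :- (m₅ :- m₄ :+ m₃ :- m₂ :+ m₁ :- con (+ 1)) :* I :* f1
               :+ (m₄ :- con (+ 3) :* m₃ :+ con (+ 7) :* m₂ :- con (+ 15) :* m₁ :+ con (+ 31))
                  :* I :* f2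
               :- (m₃ :- con (+ 6) :* m₂ :+ con (+ 25) :* m₁ :- con (+ 90)) :* I :* f3
               :+ (m₂ :- con (+ 10) :* m₁ :+ con (+ 65)) :* I :* f4
               :- (m₁ :- con (+ 15)) :* I :* f5
               :+ I :* f6
               -- Horner form: the bracket after the first `N` is `alternating N 5 ms` written out,
               -- and P stands in for M 6.
               := (P :- N :* (m₅ :- N :* (m₄ :- N :* (m₃ :- N :* (m₂ :- N :*
                    (m₁ :- N :* con (+ 1))))))) :* I)
             refl N P I (M 1) (M 2) (M 3) (M 4) (M 5) ⟩
      (P - N * alternating N 5 ms) * I
        ≈⟨ *-congʳ (+-congʳ M6≈P) ⟨
      alternating N 6 ms * I
        ≡⟨ ≡.cong (λ k → alternating N k ms * I) eq ⟨
      alternating N (length ms) ms * I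
        ≈⟨ *-congʳ (vieta N ms) ⟨
      productᵣ (map (_- N) ms) * I ∎
      where
      N = ι n
      I = P ⁻¹
      f1 : ∀ {b f} → ι 1 * b ≈ f → b ≈ f
      f1 {b} eq = trans (sym (trans (*-congʳ (+-identityʳ 1#)) (*-identityˡ b))) eq
      scale : ∀ k x b f → k * b ≈ f → k * x * I * b ≈ x * I * f
      scale k x b f eq = trans
        (solve 4 (λ k x i b → k :* x :* i :* b := x :* i :* (k :* b)) refl k x I b)
        (*-congˡ eq)
      scale′ : ∀ k b f → k * b ≈ f → k * I * b ≈ I * f
      scale′ k b f eq = trans
        (solve 3 (λ k i b → k :* i :* b := i :* (k :* b)) refl k I b)
        (*-congˡ eq)

-- Order on the reals, the geometry of 𝒰, and summation of the pointwise inequality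

module Order {c ℓ} (ℝ : RealNumbers c ℓ) where
  open import Data.Integer.Base using (+_)
  open RealNumbers ℝ
  open Sieve ℝ
  open RingProperties ring using (-‿distribʳ-*)
  open IntegerSolver commutativeRing
  open Polynomials ℝ
  open Mult semiring using (×-homo-+)

  ≤-resp₂ : ∀ {x x′ y y′} → x ≈ x′ → y ≈ y′ → x ≤ y → x′ ≤ y′
  ≤-resp₂ x≈x′ y≈y′ x≤y = ≤-respˡ-≈ x≈x′ (≤-respʳ-≈ y≈y′ x≤y)

  +-monoʳ-≤ : ∀ z {x y} → x ≤ y → z + x ≤ z + y
  +-monoʳ-≤ z x≤y = ≤-resp₂ (+-comm _ z) (+-comm _ z) (+-monoˡ-≤ z x≤y)

  +-mono-≤ : ∀ {x y u v} → x ≤ y → u ≤ v → x + u ≤ y + v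
  +-mono-≤ x≤y u≤v = ≤-trans (+-monoˡ-≤ _ x≤y) (+-monoʳ-≤ _ u≤v)

  +-cancelˡ-≤ : ∀ z {x y} → z + x ≤ z + y → x ≤ y
  +-cancelˡ-≤ z {x} {y} p = ≤-resp₂ (cancel x) (cancel y) (+-monoʳ-≤ (- z) p)
    where
    cancel : ∀ x → - z + (z + x) ≈ x
    cancel x = solve 2 (λ z x → :- z :+ (z :+ x) := x) refl z x

  x≤y⇒0≤y-x : ∀ {x y} → x ≤ y → 0# ≤ y - x
  x≤y⇒0≤y-x {x} {y} x≤y = ≤-respˡ-≈ (-‿inverseʳ x) (+-monoˡ-≤ (- x) x≤y)

  x-y≤z⇒x≤z+y : ∀ {x y z} → x - y ≤ z → x ≤ z + y
  x-y≤z⇒x≤z+y {x} {y} x-y≤z =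
    ≤-respˡ-≈ (solve 2 (λ x y → (x :- y) :+ y := x) refl x y) (+-monoˡ-≤ y x-y≤z)

  *-nonpos : ∀ {x y} → x ≤ 0# → y ≤ 0# → 0# ≤ x * y
  *-nonpos {x} {y} x≤0 y≤0 =
    ≤-respʳ-≈ (solve 2 (λ x y → (con (+ 0) :- x) :* (con (+ 0) :- y) := x :* y) refl x y)
      (*-nonneg (x≤y⇒0≤y-x x≤0) (x≤y⇒0≤y-x y≤0))

  x≤y⇒x-y≤0 : ∀ {x y} → x ≤ y → x - y ≤ 0#
  x≤y⇒x-y≤0 {x} {y} x≤y = ≤-respʳ-≈ (-‿inverseʳ y) (+-monoˡ-≤ (- y) x≤y)

  -- If x ⁻¹ ≤ 0 then 0 ≤ x (0 - x ⁻¹) = -1; adding 1 gives 1 ≤ 0, which together with 0 ≤ 1 would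
  -- make 1 equal to 0.
  ⁻¹-nonneg : ∀ {x} → 0# < x → 0# ≤ x ⁻¹
  ⁻¹-nonneg {x} (0≤x , 0≉x) with total 0# (x ⁻¹)
  ... | inj₁ 0≤x⁻¹ = 0≤x⁻¹
  ... | inj₂ x⁻¹≤0 = contradiction
    (antisym
      (≤-resp₂ (+-identityʳ 1#)
        (trans (+-congˡ (*-congˡ (+-identityˡ _)))
          (trans (+-congˡ (trans (sym (-‿distribʳ-* x _)) (-‿cong (*-inverseʳ x λ x≈0 → 0≉x (sym x≈0)))))
            (-‿inverseʳ 1#)))
        (+-monoʳ-≤ 1# (*-nonneg 0≤x (x≤y⇒0≤y-x x⁻¹≤0))))
      (0≤1 ℝ))
    1≉0

  -- For strictness: if x y were 0, multiplying by x ⁻¹ would give y = 0.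
  *-pos : ∀ {x y} → 0# < x → 0# < y → 0# < x * y
  *-pos {x} {y} (0≤x , 0≉x) (0≤y , 0≉y) = *-nonneg 0≤x 0≤y , λ 0≈xy → 0≉y (begin
    0#            ≈⟨ zeroˡ _ ⟨
    0# * x ⁻¹     ≈⟨ *-congʳ 0≈xy ⟩
    x * y * x ⁻¹  ≈⟨ solve 3 (λ x y i → x :* y :* i := (x :* i) :* y) refl x y (x ⁻¹) ⟩
    x * x ⁻¹ * y  ≈⟨ *-congʳ (*-inverseʳ x λ x≈0 → 0≉x (sym x≈0)) ⟩
    1# * y        ≈⟨ *-identityˡ y ⟩
    y             ∎)
    where open SetoidReasoning setoid

  x≤∣x∣ : ∀ x → x ≤ ∣ x ∣
  x≤∣x∣ x with 0# ≤? x
  ... | yes _   = ≤-refl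
  ... | no  0≰x with total 0# x
  ...   | inj₁ 0≤x = contradiction 0≤x 0≰x
  ...   | inj₂ x≤0 = ≤-trans x≤0 (≤-respʳ-≈ (+-identityˡ _) (x≤y⇒0≤y-x x≤0))

  -x≤∣x∣ : ∀ x → - x ≤ ∣ x ∣
  -x≤∣x∣ x with 0# ≤? x
  ... | yes 0≤x = ≤-trans (≤-respˡ-≈ (+-identityˡ _) (x≤y⇒x-y≤0 0≤x)) 0≤x
  ... | no  _   = ≤-refl

  ι-mono-≤ : ∀ {m n} → m ℕ.≤ n → ι m ≤ ι n
  ι-mono-≤ m≤n = ι-mono-≤′ ℝ (ℕₚ.≤⇒≤′ m≤n)

  ι-mono-< : ∀ {m n} → m ℕ.< n → ι m < ι n
  ι-mono-< {m} m<n = ≰⇒> λ n≤m → 1+x≰x ℝ (ι m) (≤-trans (ι-mono-≤ m<n) n≤m)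

  <-≤-trans : ∀ {x y z} → x < y → y ≤ z → x < z
  <-≤-trans x<y y≤z = ≰⇒> λ z≤x → <⇒≱ x<y (≤-trans y≤z z≤x)

  -- Once positivity is recorded separately, (0,1] is the case k = 1 of [k - 1, k].
  OddInterval : Carrier → ℕ → Set ℓ
  OddInterval x k = 2 ∤ k × ι k ≤ 1# + x × x ≤ ι k

  T⇒OddInterval : ∀ {x} → T x → ∃ (OddInterval x)
  T⇒OddInterval (inj₁ ((0≤x , _) , x≤1)) =
    1 , (λ { (divides zero ()) ; (divides (suc _) ()) }) ,
    +-monoʳ-≤ 1# 0≤x , ≤-respʳ-≈ (sym (+-identityʳ 1#)) x≤1
  T⇒OddInterval (inj₂ (k , odd , _ , k-1≤x , x≤k)) =
    k , odd , ≤-respʳ-≈ (+-comm _ 1#) (x-y≤z⇒x≤z+y k-1≤x) , x≤k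

  T⇒0< : ∀ {x} → T x → 0# < x
  T⇒0< (inj₁ (0<x , _)) = 0<x
  -- Matching on `suc k` makes the left end `ι (suc k) - 1#` equal to `ι k`, which is positive
  -- because 3 ≤ suc k.
  T⇒0< (inj₂ (suc k , _ , ℕ.s≤s 2≤k , k-1≤x , _)) = <-≤-trans
    (≰⇒> λ k≤0 → 1+x≰x ℝ 0# (≤-trans (ι-mono-≤ (ℕₚ.≤-trans (ℕ.s≤s ℕ.z≤n) 2≤k)) k≤0))
    (≤-respˡ-≈ (solve 1 (λ k → (con (+ 1) :+ k) :- con (+ 1) := k) refl (ι k)) k-1≤x)

  -- x < n forces k ≤ n.  If k < n then y ≤ 1 + x ≤ 1 + k ≤ n, and if k = n then
  -- parity gives 2 + n ≤ l ≤ 1 + y ≤ 2 + x.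
  no-integer-between : ∀ {x y k l n} → OddInterval x k → OddInterval y l → y ≤ 1# + x →
    x < ι n → ¬ ι n < y
  no-integer-between {x} {y} {k} {l} {n} (2∤k , k≤1+x , x≤k) (2∤l , l≤1+y , y≤l) y≤1+x x<n n<y
    with ℕₚ.m≤n⇒m<n∨m≡n k≤n
    where
    k≤n : k ℕ.≤ n
    -- From k - 1 ≤ x < n in the reals to k < 1 + n in ℕ.
    k≤n = ℕ.s≤s⁻¹ (ι-cancel-< ℝ (≰⇒> λ 1+n≤k →
      <⇒≱ x<n (+-cancelˡ-≤ 1# (≤-trans 1+n≤k k≤1+x))))
  ... | inj₁ k<n    = <⇒≱ n<y (≤-trans y≤1+x (≤-trans (+-monoʳ-≤ 1# x≤k) (ι-mono-≤ k<n)))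
  ... | inj₂ ≡.refl = <⇒≱ x<n (+-cancelˡ-≤ 1# (+-cancelˡ-≤ 1#
    (≤-trans (ι-mono-≤ (odd-gap 2∤k 2∤l (ι-cancel-< ℝ (<-≤-trans n<y y≤l))))
      (≤-trans l≤1+y (+-monoʳ-≤ 1# y≤1+x)))))

  -- The two factors have opposite signs, so the product has to vanish: n cannot lie strictly
  -- between x and y, hence equals one of them.
  T-straddle-nonneg : ∀ {x y} n → T x → T y → y ≤ 1# + x → x ≤ ι n → ι n ≤ y →
    0# ≤ (x - ι n) * (y - ι n)
  T-straddle-nonneg {x} {y} n Tx Ty y≤1+x x≤n n≤y with x ≟ ι n | ι n ≟ y
  ... | yes x≈n | _       = ≤-reflexive (sym (trans
    (*-congʳ (trans (+-congʳ x≈n) (-‿inverseʳ _))) (zeroˡ _)))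
  ... | _       | yes n≈y = ≤-reflexive (sym (trans
    (*-congˡ (trans (+-congʳ (sym n≈y)) (-‿inverseʳ _))) (zeroʳ _)))
  ... | no x≉n  | no n≉y  = contradiction (n≤y , n≉y)
    (no-integer-between {n = n} (proj₂ (T⇒OddInterval Tx)) (proj₂ (T⇒OddInterval Ty))
      y≤1+x (x≤n , x≉n))

  𝒰⇒pair-nonneg : ∀ {x y} → 𝒰 x y → ∀ n → 0# ≤ (x - ι n) * (y - ι n)
  𝒰⇒pair-nonneg {x} {y} (Tx , Ty , ∣x-y∣≤1) n with total x (ι n) | total y (ι n)
  ... | inj₁ x≤n | inj₁ y≤n = *-nonpos (x≤y⇒x-y≤0 x≤n) (x≤y⇒x-y≤0 y≤n)
  ... | inj₂ n≤x | inj₂ n≤y = *-nonneg (x≤y⇒0≤y-x n≤x) (x≤y⇒0≤y-x n≤y)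
  ... | inj₁ x≤n | inj₂ n≤y = T-straddle-nonneg n Tx Ty
    (x-y≤z⇒x≤z+y (≤-trans (≤-respˡ-≈ (solve 2 (λ x y → :- (x :- y) := y :- x) refl x y)
      (-x≤∣x∣ (x - y))) ∣x-y∣≤1)) x≤n n≤y
  ... | inj₂ n≤x | inj₁ y≤n = ≤-respʳ-≈ (*-comm _ _) (T-straddle-nonneg n Ty Tx
    (x-y≤z⇒x≤z+y (≤-trans (x≤∣x∣ (x - y)) ∣x-y∣≤1)) y≤n n≤x)

  module _ (M : ℕ → Carrier) (P : Carrier) where

    -- Both sides are additive in the list, so it suffices to compare the shares of a single x: 1
    -- against 1 if ν x = 0, and 0 against a nonnegative number otherwise.
    sum-of-combinations :
      (∀ n → 0# ≤ combination M P (λ r → ι (n C r))) →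
      ∀ {a} {X : Set a} (ν : X → ℕ) (xs : List X) →
      ι (length (filter (λ x → ν x ℕₚ.≟ 0) xs)) ≤
        combination M P (λ r → ι (sum (map (λ x → ν x C r) xs)))
    sum-of-combinations nonneg ν []       =
      ≤-reflexive (sym (combination-head M P (λ _ → ι 0) λ _ → refl))
    sum-of-combinations nonneg ν (x ∷ xs) = ≤-respʳ-≈
      (trans (sym (combination-+ M P b b′))
        (combination-cong M P {λ r → b r + b′ r} λ r →
          sym (×-homo-+ 1# (ν x C r) (sum (map (λ x → ν x C r) xs)))))
      step
      where
      b b′ : ℕ → Carrier
      b r = ι (ν x C r)
      b′ r = ι (sum (map (λ x → ν x C r) xs))
      ih = sum-of-combinations nonneg ν xs
      step : ι (length (filter (λ x → ν x ℕₚ.≟ 0) (x ∷ xs))) ≤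
        combination M P b + combination M P b′
      step with ν x
      ... | zero  = +-mono-≤
        (≤-reflexive (sym (trans (combination-head M P (λ r → ι (0 C r)) λ _ → refl)
          (+-identityʳ 1#)))) ih
      ... | suc n = ≤-respˡ-≈ (+-identityˡ _) (+-mono-≤ (nonneg (suc n)) ih)

  combination-binomial-nonneg : ∀ {m₁ m₂ m₃ m₄ m₅ m₆} → 𝒰 m₁ m₂ → 𝒰 m₃ m₄ → 𝒰 m₅ m₆ → ∀ n →
    0# ≤ combination (λ r → elementary r (m₁ ∷ m₂ ∷ m₃ ∷ m₄ ∷ m₅ ∷ m₆ ∷ []))
      (m₁ * m₂ * m₃ * m₄ * m₅ * m₆) (λ r → ι (n C r))
  combination-binomial-nonneg {m₁} {m₂} {m₃} {m₄} {m₅} {m₆}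
    u@(T₁ , T₂ , _) v@(T₃ , T₄ , _) w@(T₅ , T₆ , _) n =
    ≤-respʳ-≈ (sym (combination-binomial ms P M₆≈P (λ P≈0 → proj₂ 0<P (sym P≈0)) ≡.refl n))
      (*-nonneg (≤-respʳ-≈ regroup (*-nonneg (*-nonneg (𝒰⇒pair-nonneg u n) (𝒰⇒pair-nonneg v n))
        (𝒰⇒pair-nonneg w n))) (⁻¹-nonneg 0<P))
    where
    ms = m₁ ∷ m₂ ∷ m₃ ∷ m₄ ∷ m₅ ∷ m₆ ∷ []
    P = m₁ * m₂ * m₃ * m₄ * m₅ * m₆
    0<P : 0# < P
    0<P = *-pos (*-pos (*-pos (*-pos (*-pos (T⇒0< T₁) (T⇒0< T₂)) (T⇒0< T₃)) (T⇒0< T₄))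
      (T⇒0< T₅)) (T⇒0< T₆)
    M₆≈P : elementary 6 ms ≈ P
    M₆≈P = solve 6 (λ a b c d e f → a :* (b :* (c :* (d :* (e :* (f :* con (+ 1)))))) :+ con (+ 0)
      := a :* b :* c :* d :* e :* f) refl m₁ m₂ m₃ m₄ m₅ m₆
    regroup : (m₁ - ι n) * (m₂ - ι n) * ((m₃ - ι n) * (m₄ - ι n)) * ((m₅ - ι n) * (m₆ - ι n)) ≈
      productᵣ (map (_- ι n) ms)
    regroup = solve 6 (λ a b c d e f → a :* b :* (c :* d) :* (e :* f)
      := a :* (b :* (c :* (d :* (e :* (f :* con (+ 1))))))) refl
      (m₁ - ι n) (m₂ - ι n) (m₃ - ι n) (m₄ - ι n) (m₅ - ι n) (m₆ - ι n)

-- The sieve counts as sums of binomial coefficients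

module Counting {c ℓ} (ℝ : RealNumbers c ℓ) where
  open ≡
  open import Data.Nat.Base using (_+_; _*_)
  open RealNumbers ℝ using (Carrier; ι; ≮⇒≥)
    renaming (_≤_ to _≤ᵣ_; <⇒≱ to <ᵣ⇒≱ᵣ)
  open Sieve ℝ
  open Order ℝ using (<-≤-trans; ι-mono-<)

  ω : Carrier → Carrier → ℕ → ℕ
  ω w z a = length (filter (_∣? a) (primes w z))

  PrimeIn-widen : ∀ {w y z p} → y ≤ᵣ z → PrimeIn w y p → PrimeIn w z p
  PrimeIn-widen y≤z (pp , w≤p , p<y) = pp , w≤p , <-≤-trans p<y y≤z

  primeTuples-PrimeIn : ∀ r {w z ps} → ps ∈ primeTuples r w z → All (PrimeIn w z) ps
  primeTuples-PrimeIn zero    (here refl) = []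
  primeTuples-PrimeIn (suc r) {w} {z} ps∈
    with p , p∈ , ps∈p ←
      find (∈-concatMap⁻ (λ p → map (p ∷_) (primeTuples r w (ι p))) {xs = primes w z} ps∈)
    with qs , qs∈ , refl ← ∈-map⁻ (p ∷_) ps∈p
    with pp@(_ , _ , p<z , _) ← to (∈-primes w z) p∈
    = pp ∷ All.map (PrimeIn-widen p<z) (primeTuples-PrimeIn r qs∈)

  module _ (w : Carrier) where

    -- Rewrites the primes below p, enumerated up to `ceil` of `ι p`, as an initial segment for one
    -- predicate independent of p. This is the shape that `hockey-stick` expects; p ≤ z makes the
    -- bound by z automatic.
    ω-below : ∀ {z p} → ι p ≤ᵣ z → ∀ a →
      ω w (ι p) a ≡ length (filter (λ q → primeIn? w z q ×-dec q ∣? a) (upTo p))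
    ω-below {z} {p} p≤z a = length-set
      (Unique.filter⁺ (_∣? a) (Unique.filter⁺ (primeIn? w (ι p)) (Unique.upTo⁺ (ceil ℝ (ι p)))))
      (Unique.filter⁺ Q? (Unique.upTo⁺ p))
      (mk⇔ below above)
      where
      Q? = λ q → primeIn? w z q ×-dec q ∣? a
      below : ∀ {q} → q ∈ filter (_∣? a) (primes w (ι p)) → q ∈ filter Q? (upTo p)
      below q∈ with q∈′ , q∣a ← ∈-filter⁻ (_∣? a) {xs = primes w (ι p)} q∈
        with pq ← to (∈-primes w (ι p)) q∈′ =
        ∈-filter⁺ Q? (∈-upTo⁺ (ι-cancel-< ℝ {n = p} (proj₂ (proj₂ pq)))) (PrimeIn-widen p≤z pq , q∣a)
      above : ∀ {q} → q ∈ filter Q? (upTo p) → q ∈ filter (_∣? a) (primes w (ι p))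
      above q∈ with q∈′ , (pq , w≤q , _) , q∣a ← ∈-filter⁻ Q? {xs = upTo p} q∈ =
        ∈-filter⁺ (_∣? a) (from (∈-primes w (ι p)) (pq , w≤q , ι-mono-< (∈-upTo⁻ q∈′))) q∣a

    -- Sort the tuples by their largest prime p. The remaining primes form an r-tuple below p, so by
    -- induction their number is a binomial coefficient in the count of prime divisors below p;
    -- `hockey-stick` sums these over p ∣ a.
    tuples-dividing : ∀ r z a →
      sum (map (λ ps → indicator (product ps ∣? a)) (primeTuples r w z)) ≡ ω w z a C r
    tuples-dividing zero z a = cong (_+ 0) (indicator-true (1 ∣? a) (1∣ a))
    tuples-dividing (suc r) z a = begin
      sum (map f (concatMap (λ p → map (p ∷_) (primeTuples r w (ι p))) (primes w z)))
        ≡⟨ sum-map-concatMap f _ (primes w z) ⟩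
      sum (map (λ p → sum (map f (map (p ∷_) (primeTuples r w (ι p))))) (primes w z))
        ≡⟨ cong sum (map-cong-local (All.tabulate λ p∈ → first (to (∈-primes w z) p∈))) ⟩
      sum (map (λ p → indicator (p ∣? a) * (ω w (ι p) a C r)) (primes w z))
        ≡⟨ sum-map-filter (_∣? a) (λ p → ω w (ι p) a C r) (primes w z) ⟨
      sum (map (λ p → ω w (ι p) a C r) (filter (_∣? a) (primes w z)))
        ≡⟨ cong (sum ∘ map (λ p → ω w (ι p) a C r)) fuse ⟩
      sum (map (λ p → ω w (ι p) a C r) (filter Q? (upTo (ceil ℝ z))))
        ≡⟨ cong sum (map-cong-local (All.tabulate λ {p} p∈ → cong (_C r)
             (ω-below {p = p} (p≤z p∈) a))) ⟩
      sum (map (λ p → length (filter Q? (upTo p)) C r) (filter Q? (upTo (ceil ℝ z))))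
        ≡⟨ hockey-stick Q? r (ceil ℝ z) ⟩
      length (filter Q? (upTo (ceil ℝ z))) C suc r
        ≡⟨ cong (λ ps → length ps C suc r) fuse ⟨
      ω w z a C suc r ∎
      where
      open ≡-Reasoning
      f : List ℕ → ℕ
      f ps = indicator (product ps ∣? a)
      Q? = λ q → primeIn? w z q ×-dec q ∣? a
      fuse : filter (_∣? a) (primes w z) ≡ filter Q? (upTo (ceil ℝ z))
      fuse = filter-filter (primeIn? w z) (_∣? a) (upTo (ceil ℝ z))
      p≤z : ∀ {p} → p ∈ filter Q? (upTo (ceil ℝ z)) → ι p ≤ᵣ z
      p≤z p∈ with _ , (_ , _ , p≤z , _) , _ ← ∈-filter⁻ Q? {xs = upTo (ceil ℝ z)} p∈ = p≤z
      -- The primes after p in a tuple are strictly smaller, so p is not among them. This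
      -- coprimality lets divisibility by the product split.
      p∤product : ∀ {p ps} → Prime p → All (PrimeIn w (ι p)) ps → p ∤ product ps
      p∤product pp pps p∣ps
        with _ , _ , _ , p≉p ← All.lookup pps (prime∣product⇒∈ pp (All.map proj₁ pps) p∣ps) =
        p≉p (RealNumbers.refl ℝ)
      first : ∀ {p} → PrimeIn w z p →
        sum (map f (map (p ∷_) (primeTuples r w (ι p)))) ≡ indicator (p ∣? a) * (ω w (ι p) a C r)
      first {p} (pp , _) = begin
        sum (map f (map (p ∷_) (primeTuples r w (ι p))))
          ≡⟨ cong sum (map-∘ (primeTuples r w (ι p))) ⟨
        sum (map (λ ps → f (p ∷ ps)) (primeTuples r w (ι p)))
          ≡⟨ cong sum (map-cong-local (All.tabulate λ {ps} ps∈ →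
               indicator-× (p ∣? a) (product ps ∣? a) (p * product ps ∣? a)
                 (p*d∣n⇔p∣n×d∣n pp (p∤product pp (primeTuples-PrimeIn r ps∈))))) ⟩
        sum (map (λ ps → indicator (p ∣? a) * f ps) (primeTuples r w (ι p)))
          ≡⟨ sum-map-*ˡ (indicator (p ∣? a)) f (primeTuples r w (ι p)) ⟩
        indicator (p ∣? a) * sum (map f (primeTuples r w (ι p)))
          ≡⟨ cong (indicator (p ∣? a) *_) (tuples-dividing r (ι p) a) ⟩
        indicator (p ∣? a) * (ω w (ι p) a C r) ∎

    module _ (A : List ℕ) (unique : Unique A) where

      -- Multiplication by d is a bijection from A_d onto the multiples of d in A. As d is w-rough
      -- and w-roughness passes to divisors, b is w-rough exactly when b d is.
      S-/ₛ : ∀ d .{{_ : NonZero d}} → Rough w d →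
        S (A /ₛ d) w ≡ length (filter (d ∣?_) (filter (rough? w) A))
      S-/ₛ d rough-d = trans (sym (length-map (_* d) (filter (rough? w) (A /ₛ d)))) (length-set
        (Unique.map⁺ (λ {x} {y} → ℕₚ.*-cancelʳ-≡ x y d)
          (Unique.filter⁺ (rough? w)
            (Unique.filter⁺ (λ a → a * d ∈? A) (Unique.upTo⁺ (suc (max 0 A))))))
        (Unique.filter⁺ (d ∣?_) (Unique.filter⁺ (rough? w) unique))
        (mk⇔ multiple cofactor))
        where
        multiple : ∀ {a} → a ∈ map (_* d) (filter (rough? w) (A /ₛ d)) →
          a ∈ filter (d ∣?_) (filter (rough? w) A)
        multiple a∈ with b , b∈ , refl ← ∈-map⁻ (_* d) a∈
          with b∈′ , rough-b ← ∈-filter⁻ (rough? w) {xs = A /ₛ d} b∈ =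
          ∈-filter⁺ (d ∣?_) (∈-filter⁺ (rough? w) (to (∈-/ₛ A d {b}) b∈′) rough-bd) (n∣m*n b)
          where
          rough-bd : Rough w (b * d)
          rough-bd pp p∣bd with euclidsLemma b d pp p∣bd
          ... | inj₁ p∣b = rough-b pp p∣b
          ... | inj₂ p∣d = rough-d pp p∣d
        cofactor : ∀ {a} → a ∈ filter (d ∣?_) (filter (rough? w) A) →
          a ∈ map (_* d) (filter (rough? w) (A /ₛ d))
        cofactor a∈ with a∈′ , divides b refl ← ∈-filter⁻ (d ∣?_) {xs = filter (rough? w) A} a∈
          with a∈A , rough-a ← ∈-filter⁻ (rough? w) {xs = A} a∈′ =
          ∈-map⁺ (_* d) (∈-filter⁺ (rough? w) (from (∈-/ₛ A d {b}) a∈A)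
            λ pp p∣b → rough-a pp (∣m⇒∣m*n d p∣b))

      -- Double counting of the pairs of a tuple and a w-rough element divisible by its product.
      -- Such a product is itself w-rough, all its prime factors being at least w.
      ∑S≡∑C : ∀ r z → ∑S r A w z ≡ sum (map (λ a → ω w z a C r) (filter (rough? w) A))
      ∑S≡∑C r z = begin
        sum (map (λ ps → S (A /ₛ product ps) w) (primeTuples r w z))
          ≡⟨ cong sum (map-cong-local (All.tabulate λ ps∈ → each (primeTuples-PrimeIn r ps∈))) ⟩
        sum (map (λ ps → sum (map (λ a → indicator (product ps ∣? a)) A′)) (primeTuples r w z))
          ≡⟨ sum-map-swap (λ ps a → indicator (product ps ∣? a)) (primeTuples r w z) A′ ⟩
        sum (map (λ a → sum (map (λ ps → indicator (product ps ∣? a)) (primeTuples r w z))) A′)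
          ≡⟨ cong sum (map-cong (tuples-dividing r z) A′) ⟩
        sum (map (λ a → ω w z a C r) A′) ∎
        where
        open ≡-Reasoning
        A′ = filter (rough? w) A
        each : ∀ {ps} → All (PrimeIn w z) ps →
          S (A /ₛ product ps) w ≡ sum (map (λ a → indicator (product ps ∣? a)) A′)
        each {ps} pps = trans
          (S-/ₛ (product ps) {{productOfPrimes≢0 (All.map proj₁ pps)}}
            λ pq q∣ps q<w → <ᵣ⇒≱ᵣ q<w
              (proj₁ (proj₂ (All.lookup pps (prime∣product⇒∈ pq (All.map proj₁ pps) q∣ps)))))
          (length-filter≡sum (product ps ∣?_) A′)

    -- A prime below z dividing a is either below w, contradicting w-roughness, or lies in [w, z)
    -- and is counted by `ω`.
    S≡count : ∀ {z} A → w ≤ᵣ z →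
      S A z ≡ length (filter (λ a → ω w z a ℕₚ.≟ 0) (filter (rough? w) A))
    S≡count {z} A w≤z = cong length (trans
      (filter-≐ (rough? z) (λ a → rough? w a ×-dec ω w z a ℕₚ.≟ 0) (forwards , backwards) A)
      (sym (filter-filter (rough? w) (λ a → ω w z a ℕₚ.≟ 0) A)))
      where
      forwards : ∀ {a} → Rough z a → Rough w a × ω w z a ≡ 0
      forwards {a} rough = (λ pp p∣a p<w → rough pp p∣a (<-≤-trans p<w w≤z)) ,
        cong length (filter-none (_∣? a) {xs = primes w z} (All.tabulate λ p∈ p∣a →
          let pp , _ , p<z = to (∈-primes w z) p∈ in rough pp p∣a p<z))
      backwards : ∀ {a} → Rough w a × ω w z a ≡ 0 → Rough z a
      backwards {a} (rough , ω≡0) {p} pp p∣a p<z = ℕₚ.<-irrefl (sym ω≡0) (∈-length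
        {xs = filter (_∣? a) (primes w z)}
        (∈-filter⁺ (_∣? a) (from (∈-primes w z {p}) (pp , ≮⇒≥ (rough pp p∣a) , p<z)) p∣a))

theorem4 : ∀ {c ℓ} (ℝ : RealNumbers c ℓ) →
  let open RealNumbers ℝ
      open Sieve ℝ
  in (A : List ℕ) → Unique A → All NonZero A →
     (w z : Carrier) → w ≤ z →
     (m₁ m₂ m₃ m₄ m₅ m₆ : Carrier) → 𝒰 m₁ m₂ → 𝒰 m₃ m₄ → 𝒰 m₅ m₆ →
     let M : ℕ → Carrier
         M r = elementary r (m₁ ∷ m₂ ∷ m₃ ∷ m₄ ∷ m₅ ∷ m₆ ∷ [])
         P : Carrier
         P = m₁ * m₂ * m₃ * m₄ * m₅ * m₆
     in ι (S A z) ≤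
          ι (S A w)
          - (M 5 - M 4 + M 3 - M 2 + M 1 - 1#) / P * ι (∑S 1 A w z)
          + ι 2 * (M 4 - ι 3 * M 3 + ι 7 * M 2 - ι 15 * M 1 + ι 31) / P * ι (∑S 2 A w z)
          - ι 6 * (M 3 - ι 6 * M 2 + ι 25 * M 1 - ι 90) / P * ι (∑S 3 A w z)
          + ι 24 * (M 2 - ι 10 * M 1 + ι 65) / P * ι (∑S 4 A w z)
          - ι 120 * (M 1 - ι 15) / P * ι (∑S 5 A w z)
          + ι 720 / P * ι (∑S 6 A w z)
theorem4 ℝ A unique _ w z w≤z m₁ m₂ m₃ m₄ m₅ m₆ u₁₂ u₃₄ u₅₆ =
  ≤-resp₂ (reflexive (≡.cong ι (≡.sym (S≡count w A w≤z)))) (combination-cong M P counts)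
    (sum-of-combinations M P (combination-binomial-nonneg u₁₂ u₃₄ u₅₆) (ω w z) (filter (rough? w) A))
  where
  open RealNumbers ℝ
  open Sieve ℝ
  open Polynomials ℝ
  open Order ℝ
  open Counting ℝ
  M : ℕ → Carrier
  M r = elementary r (m₁ ∷ m₂ ∷ m₃ ∷ m₄ ∷ m₅ ∷ m₆ ∷ [])
  P : Carrier
  P = m₁ * m₂ * m₃ * m₄ * m₅ * m₆
  σ : ℕ → ℕ
  -- `∑S 0 A w z` would unfold to `S (A /ₛ 1) w` plus 0, so the entry at 0 is `S A w` itself.
  σ zero    = S A w
  σ (suc r) = ∑S (suc r) A w z
  counts : ∀ r → ι (sum (map (λ a → ω w z a C r) (filter (rough? w) A))) ≈ ι (σ r)
  counts zero    = reflexive (≡.cong ι (sum-map-1 (filter (rough? w) A)))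
  counts (suc r) = reflexive (≡.cong ι (≡.sym (∑S≡∑C w A unique (suc r) z)))
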